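{- Let $A=(a_{ijk})_{i,j,k\in\{1,2\}}$ be a $2\times2\times2$ hypermatrix with integer entries and $f(\mathbf{x},\mathbf{y},\mathbf{z})=\sum_{i,j,k}a_{ijk}x_iy_jz_k$ the associated trilinear form. Define the binary quadratic forms $\Delta_{xy}(\mathbf{z})=\det\big(\sum_k a_{ijk}z_k\big)_{i,j}$, $\Delta_{yz}(\mathbf{x})=\det\big(\sum_i a_{ijk}x_i\big)_{j,k}$, $\Delta_{zx}(\mathbf{y})=\det\big(\sum_j a_{ijk}y_j\big)_{i,k}$. Then: (i) If $\Delta_{xy}$ vanishes identically, then $\Delta_{yz}$ or $\Delta_{zx}$ also vanishes identically. (ii) If $\Delta_{xy}$ and $\Delta_{yz}$ both vanish identically, then $f$ factorizes over $\mathbb{Q}$ as $f(\mathbf{x},\mathbf{y},\mathbf{z})=L(\mathbf{y})B(\mathbf{x},\mathbf{z})$, where $L$ is a linear form and $B$ is a bilinear form; furthermore $\Delta_{zx}(\mathbf{y})=\det(B)L(\mathbf{y})^2$, where $\det(B)$ is the determinant of the $2\times2$ matrix associated to $B$. (iii) If $f$ has a linear factor $L(\mathbf{y})$ over $\mathbb{Z}$ (a linear form in $\mathbf{y}$ alone), then $\Delta_{xy}$ and $\Delta_{yz}$ both vanish identically. (iv) $f$ splits into three linear factors over $\mathbb{Z}$ if and only if $\Delta_{xy}$, $\Delta_{yz}$ and $\Delta_{zx}$ all vanish identically.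
   Context: Here $\mathbf{x}=(x_1,x_2)$, $\mathbf{y}=(y_1,y_2)$, $\mathbf{z}=(z_1,z_2)$. Explicitly, $\Delta_{xy}(\mathbf{z})=(a_{111}a_{221}-a_{121}a_{211})z_1^2+(a_{111}a_{222}+a_{112}a_{221}-a_{212}a_{121}-a_{211}a_{122})z_1z_2+(a_{112}a_{222}-a_{122}a_{212})z_2^2$, $\Delta_{yz}(\mathbf{x})=(a_{111}a_{122}-a_{112}a_{121})x_1^2+(a_{111}a_{222}+a_{211}a_{122}-a_{112}a_{221}-a_{212}a_{121})x_1x_2+(a_{211}a_{222}-a_{212}a_{221})x_2^2$, $\Delta_{zx}(\mathbf{y})=(a_{111}a_{212}-a_{112}a_{211})y_1^2+(a_{111}a_{222}+a_{212}a_{121}-a_{112}a_{221}-a_{211}a_{122})y_1y_2+(a_{121}a_{222}-a_{122}a_{221})y_2^2$. "Vanishes identically" means all coefficients are zero. -}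

module Defs where

open import Data.Fin using (Fin; zero; suc)
open import Data.Integer using (ℤ; _+_; _-_; _*_; 0ℤ; +_)
open import Data.Product using (_×_; Σ; _,_; ∃)
open import Relation.Binary.PropositionalEquality using (_≡_)
open import Relation.Nullary using (¬_)
import Data.Rational as Q

-- A 2×2×2 hypermatrix with integer entries; A i j k = a_{(i+1)(j+1)(k+1)}.
-- Index i goes with x, j with y, k with z:  f(x,y,z) = Σ a_{ijk} x_i y_j z_k.
Hyper : Set
Hyper = Fin 2 → Fin 2 → Fin 2 → ℤ

𝟙 𝟚 : Fin 2
𝟙 = zero
𝟚 = suc zero

-- A binary quadratic form c₁ u₁² + c₂ u₁u₂ + c₃ u₂², stored by its coefficients.
record BQF : Set where
  constructor bqf
  field
    c₁ c₂ c₃ : ℤ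

VanishesId : BQF → Set
VanishesId (bqf p q r) = (p ≡ 0ℤ) × (q ≡ 0ℤ) × (r ≡ 0ℤ)

module _ (A : Hyper) where
  private
    a : Fin 2 → Fin 2 → Fin 2 → ℤ
    a = A

  -- Δ_xy(z) = det( Σ_k a_{ijk} z_k )_{i,j}
  Δxy : BQF
  Δxy = bqf (a 𝟙 𝟙 𝟙 * a 𝟚 𝟚 𝟙 - a 𝟙 𝟚 𝟙 * a 𝟚 𝟙 𝟙)
            (a 𝟙 𝟙 𝟙 * a 𝟚 𝟚 𝟚 + a 𝟙 𝟙 𝟚 * a 𝟚 𝟚 𝟙 - a 𝟚 𝟙 𝟚 * a 𝟙 𝟚 𝟙 - a 𝟚 𝟙 𝟙 * a 𝟙 𝟚 𝟚)
            (a 𝟙 𝟙 𝟚 * a 𝟚 𝟚 𝟚 - a 𝟙 𝟚 𝟚 * a 𝟚 𝟙 𝟚)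

  -- Δ_yz(x) = det( Σ_i a_{ijk} x_i )_{j,k}
  Δyz : BQF
  Δyz = bqf (a 𝟙 𝟙 𝟙 * a 𝟙 𝟚 𝟚 - a 𝟙 𝟙 𝟚 * a 𝟙 𝟚 𝟙)
            (a 𝟙 𝟙 𝟙 * a 𝟚 𝟚 𝟚 + a 𝟚 𝟙 𝟙 * a 𝟙 𝟚 𝟚 - a 𝟙 𝟙 𝟚 * a 𝟚 𝟚 𝟙 - a 𝟚 𝟙 𝟚 * a 𝟙 𝟚 𝟙)
            (a 𝟚 𝟙 𝟙 * a 𝟚 𝟚 𝟚 - a 𝟚 𝟙 𝟚 * a 𝟚 𝟚 𝟙)

  -- Δ_zx(y) = det( Σ_j a_{ijk} y_j )_{i,k}
  Δzx : BQF
  Δzx = bqf (a 𝟙 𝟙 𝟙 * a 𝟚 𝟙 𝟚 - a 𝟙 𝟙 𝟚 * a 𝟚 𝟙 𝟙)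
            (a 𝟙 𝟙 𝟙 * a 𝟚 𝟚 𝟚 + a 𝟚 𝟙 𝟚 * a 𝟙 𝟚 𝟙 - a 𝟙 𝟙 𝟚 * a 𝟚 𝟚 𝟙 - a 𝟚 𝟙 𝟙 * a 𝟙 𝟚 𝟚)
            (a 𝟙 𝟚 𝟙 * a 𝟚 𝟚 𝟚 - a 𝟙 𝟚 𝟚 * a 𝟚 𝟚 𝟙)

ι : ℤ → Q.ℚ
ι n = n Q./ 1

-- Coefficient vectors of linear forms (L(y) = l₁ y₁ + l₂ y₂) and
-- coefficient matrices of bilinear forms (B(x,z) = Σ b_{ik} x_i z_k).
LinQ : Set
LinQ = Fin 2 → Q.ℚ

BilQ : Set
BilQ = Fin 2 → Fin 2 → Q.ℚ

detQ : BilQ → Q.ℚ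
detQ b = b 𝟙 𝟙 Q.* b 𝟚 𝟚 Q.- b 𝟙 𝟚 Q.* b 𝟚 𝟙

-- f(x,y,z) = L(y) B(x,z) as polynomials over ℚ, i.e. a_{ijk} = l_j b_{ik}
FactorsQ : Hyper → LinQ → BilQ → Set
FactorsQ A l b = ∀ i j k → ι (A i j k) ≡ l j Q.* b i k

-- The polynomial identity Δ_zx(y) = det(B) L(y)² over ℚ, coefficientwise:
-- L(y)² = l₁² y₁² + 2 l₁ l₂ y₁y₂ + l₂² y₂².
ΔzxFormula : Hyper → LinQ → BilQ → Set
ΔzxFormula A l b =
  (ι (BQF.c₁ (Δzx A)) ≡ detQ b Q.* (l 𝟙 Q.* l 𝟙)) ×
  (ι (BQF.c₂ (Δzx A)) ≡ detQ b Q.* ((ι (+ 2) Q.* l 𝟙) Q.* l 𝟚)) ×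
  (ι (BQF.c₃ (Δzx A)) ≡ detQ b Q.* (l 𝟚 Q.* l 𝟚))

-- f has a linear factor L(y) over ℤ: f = L(y)·g with L a nonzero integral linear
-- form in y alone and g an integral polynomial; by degree/trilinearity g is a
-- bilinear form in (x,z), so this means a_{ijk} = l_j b_{ik}.
HasLinearFactorYℤ : Hyper → Set
HasLinearFactorYℤ A =
  Σ (Fin 2 → ℤ) λ l → Σ (Fin 2 → Fin 2 → ℤ) λ b →
    (¬ (∀ j → l j ≡ 0ℤ)) × (∀ i j k → A i j k ≡ l j * b i k)

-- f splits into three linear factors over ℤ: f = L₁(x) L₂(y) L₃(z),
-- i.e. a_{ijk} = u_i v_j w_k with integer u, v, w.
SplitsLinearℤ : Hyper → Set
SplitsLinearℤ A =
  Σ (Fin 2 → ℤ) λ u → Σ (Fin 2 → ℤ) λ v → Σ (Fin 2 → ℤ) λ w →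
    ∀ i j k → A i j k ≡ u i * v j * w k

-- Write fₖ(x, y) for the coefficient of z_k in f. At z* = (f₂, −f₁), which spans the
-- kernel of z ↦ f(x, y, z), one has the identity Δyz(x) Δzx(y) = −Δxy(z*); so if Δxy ≡ 0
-- the values of Δyz and Δzx multiply to zero everywhere and one of the two forms is zero.
-- Up to a factor 2 the coefficients of Δxy and Δyz are the 2×2 minors of the four
-- "y-fibres" (a_{i1k}, a_{i2k}), so both forms vanish iff these vectors are pairwise
-- parallel. Pairwise parallel integer vectors are multiples of one unimodular vector
-- (a nonzero one divided by its gcd, unimodular by Bézout), which gives a_{ijk} = l_j b_{ik}
-- with l unimodular; conversely such a factorisation kills Δxy and Δyz. For it
-- Δzx = det(b) L², and as l ≠ 0 the vanishing of Δzx forces det b = 0: the rows of b are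
-- parallel and factor once more as b_{ik} = u_i w_k.
module Submission where

open import Defs
open import Data.Product using (_×_; Σ)
open import Data.Sum using (_⊎_)
open import Function.Bundles using (_⇔_)

open import Data.Fin.Base using (Fin; zero; suc)
open import Data.Fin.Properties using (any?)
open import Data.Integer.Base as ℤ using (ℤ; +_; 0ℤ; 1ℤ; -1ℤ; _+_; _*_; _-_; -_; ∣_∣; ≢-nonZero)
open import Data.Integer.Divisibility.Signed using (_∣_; divides; ∣ᵤ⇒∣)
open import Data.Integer.GCD using (gcd; gcd[i,j]∣i; gcd[i,j]∣j; gcd[i,j]≡0⇒i≡0; gcd[i,j]≡0⇒j≡0)
open import Data.Integer.Properties
  using (_≟_; *-comm; *-identityˡ; -1*i≡-i; +∣i∣≡i⊎+∣i∣≡-i; pos-+; pos-*; i*j≡0⇒i≡0∨j≡0; *-cancelʳ-≡)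
open import Data.Integer.Tactic.RingSolver using (solve-∀)
import Data.Nat.Base as ℕ
open import Data.Nat.GCD using (gcd-GCD; module Bézout) renaming (gcd to ℕ-gcd)
open import Data.Product using (_,_; ∃; ∃₂; proj₁; proj₂)
import Data.Rational as Q
open import Data.Rational.Properties using (toℚᵘ-injective; toℚᵘ-fromℚᵘ; toℚᵘ-homo-+; toℚᵘ-homo-*; toℚᵘ-homo‿-)
open import Data.Rational.Unnormalised.Base using (mkℚᵘ; _≃_; *≡*) renaming (_+_ to _+ᵘ_; _*_ to _*ᵘ_; -_ to -ᵘ_)
open import Data.Rational.Unnormalised.Properties using (+-cong; *-cong; -‿cong; module ≃-Reasoning)
open import Data.Sum using (inj₁; inj₂; [_,_]′)
open import Data.Vec.Functional using ([]; _∷_)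
open import Function.Base using (id; _∘_)
open import Function.Bundles using (mk⇔)
open import Relation.Binary.PropositionalEquality
open import Relation.Nullary using (¬_; Dec; yes; no; contradiction)
open import Relation.Nullary.Decidable using (_×-dec_; ¬?; decidable-stable; map′)

cong₃ : ∀ {A B C D : Set} (f : A → B → C → D) {a a′ b b′ c c′} →
  a ≡ a′ → b ≡ b′ → c ≡ c′ → f a b c ≡ f a′ b′ c′
cong₃ f refl refl refl = refl

i*j≡0⇒i≡0 : ∀ {i j} → j ≢ 0ℤ → i * j ≡ 0ℤ → i ≡ 0ℤ
i*j≡0⇒i≡0 {i} j≢0 ij≡0 = [ id , (λ j≡0 → contradiction j≡0 j≢0) ]′ (i*j≡0⇒i≡0∨j≡0 i ij≡0)

i*j≡0⇒j≡0 : ∀ {i j} → i ≢ 0ℤ → i * j ≡ 0ℤ → j ≡ 0ℤ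
i*j≡0⇒j≡0 {i} {j} i≢0 ij≡0 = i*j≡0⇒i≡0 i≢0 (trans (*-comm j i) ij≡0)

sum-and-difference≡0 : ∀ {x y} → x + y ≡ 0ℤ → x - y ≡ 0ℤ → x ≡ 0ℤ × y ≡ 0ℤ
sum-and-difference≡0 {x} {y} x+y≡0 x-y≡0 =
  i*j≡0⇒i≡0 (λ ()) (trans (sum x y) (cong₂ _+_ x+y≡0 x-y≡0)) ,
  i*j≡0⇒i≡0 (λ ()) (trans (difference x y) (cong₂ _-_ x+y≡0 x-y≡0))
  where
  sum : ∀ x y → x * + 2 ≡ (x + y) + (x - y)
  sum = solve-∀
  difference : ∀ x y → y * + 2 ≡ (x + y) - (x - y)
  difference = solve-∀

square≡0⇒≡0 : ∀ {i} → i * i ≡ 0ℤ → i ≡ 0ℤ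
square≡0⇒≡0 {i} i²≡0 = [ id , id ]′ (i*j≡0⇒i≡0∨j≡0 i i²≡0)

cross : (Fin 2 → ℤ) → (Fin 2 → ℤ) → ℤ
cross u v = u 𝟙 * v 𝟚 - u 𝟚 * v 𝟙

cross-self : ∀ u → cross u u ≡ 0ℤ
cross-self u = identity (u 𝟙) (u 𝟚)
  where
  identity : ∀ a b → a * b - b * a ≡ 0ℤ
  identity = solve-∀

parallel-sym : ∀ u v → cross u v ≡ 0ℤ → cross v u ≡ 0ℤ
parallel-sym u v u×v≡0 = trans (antisym (u 𝟙) (u 𝟚) (v 𝟙) (v 𝟚)) (cong -_ u×v≡0)
  where
  antisym : ∀ a b c d → c * b - d * a ≡ - (a * d - b * c)
  antisym = solve-∀

IsZero : (Fin 2 → ℤ) → Set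
IsZero u = u 𝟙 ≡ 0ℤ × u 𝟚 ≡ 0ℤ

isZero? : ∀ u → Dec (IsZero u)
isZero? u = (u 𝟙 ≟ 0ℤ) ×-dec (u 𝟚 ≟ 0ℤ)

Unimodular : (Fin 2 → ℤ) → Set
Unimodular v = ∃₂ λ α β → α * v 𝟙 + β * v 𝟚 ≡ 1ℤ

+∣i∣-multiple : ∀ i → ∃ λ s → + ∣ i ∣ ≡ s * i
+∣i∣-multiple i with +∣i∣≡i⊎+∣i∣≡-i i
... | inj₁ ∣i∣≡i  = 1ℤ , trans ∣i∣≡i (sym (*-identityˡ i))
... | inj₂ ∣i∣≡-i = -1ℤ , trans ∣i∣≡-i (sym (-1*i≡-i i))

ℕ-identity⇒ℤ : ∀ d m n x y → d ℕ.+ y ℕ.* n ≡ x ℕ.* m → + d + + y * + n ≡ + x * + m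
ℕ-identity⇒ℤ d m n x y eq = begin
  + d + + y * + n        ≡⟨ cong (λ e → + d + e) (sym (pos-* y n)) ⟩
  + d + + (y ℕ.* n)      ≡⟨ sym (pos-+ d (y ℕ.* n)) ⟩
  + (d ℕ.+ y ℕ.* n)      ≡⟨ cong +_ eq ⟩
  + (x ℕ.* m)            ≡⟨ pos-* x m ⟩
  + x * + m              ∎
  where open ≡-Reasoning

bézout-ℕ : ∀ m n → ∃₂ λ α β → α * + m + β * + n ≡ + ℕ-gcd m n
bézout-ℕ m n with Bézout.identity (gcd-GCD m n)
... | Bézout.+- x y eq = + x , - + y , (begin
  + x * + m + - + y * + n               ≡⟨ cong (_+ - + y * + n) (sym (ℕ-identity⇒ℤ d m n x y eq)) ⟩
  (+ d + + y * + n) + - + y * + n       ≡⟨ cancel (+ d) (+ y) (+ n) ⟩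
  + d                                   ∎)
  where
  open ≡-Reasoning
  d : ℕ.ℕ
  d = ℕ-gcd m n
  cancel : ∀ D Y N → (D + Y * N) + - Y * N ≡ D
  cancel = solve-∀
... | Bézout.-+ x y eq = - + x , + y , (begin
  - + x * + m + + y * + n               ≡⟨ cong (λ e → - + x * + m + e) (sym (ℕ-identity⇒ℤ d n m y x eq)) ⟩
  - + x * + m + (+ d + + x * + m)       ≡⟨ cancel (+ d) (+ x) (+ m) ⟩
  + d                                   ∎)
  where
  open ≡-Reasoning
  d : ℕ.ℕ
  d = ℕ-gcd m n
  cancel : ∀ D X M → - X * M + (D + X * M) ≡ D
  cancel = solve-∀

bézout : ∀ i j → ∃₂ λ α β → α * i + β * j ≡ gcd i j
bézout i j with +∣i∣-multiple i | +∣i∣-multiple j | bézout-ℕ ∣ i ∣ ∣ j ∣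
... | s , ∣i∣≡si | r , ∣j∣≡rj | α , β , eq = α * s , β * r , (begin
  α * s * i + β * r * j          ≡⟨ reassociate α β s r i j ⟩
  α * (s * i) + β * (r * j)      ≡⟨ cong₂ (λ a b → α * a + β * b) (sym ∣i∣≡si) (sym ∣j∣≡rj) ⟩
  α * + ∣ i ∣ + β * + ∣ j ∣      ≡⟨ eq ⟩
  gcd i j                        ∎)
  where
  open ≡-Reasoning
  reassociate : ∀ α β s r i j → α * s * i + β * r * j ≡ α * (s * i) + β * (r * j)
  reassociate = solve-∀

unimodular-quotient : ∀ {g} (u : Fin 2 → ℤ) → g ≢ 0ℤ → g ∣ u 𝟙 → g ∣ u 𝟚 →
  (∃₂ λ α β → α * u 𝟙 + β * u 𝟚 ≡ g) →
  ∃ λ v → Unimodular v × (∀ j → u j ≡ v j * g)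
unimodular-quotient {g} u g≢0 (divides v₁ u₁≡v₁g) (divides v₂ u₂≡v₂g) (α , β , bz) =
  (v₁ ∷ v₂ ∷ []) ,
  (α , β , *-cancelʳ-≡ (α * v₁ + β * v₂) 1ℤ g {{≢-nonZero g≢0}} combination) ,
  λ where
    zero       → u₁≡v₁g
    (suc zero) → u₂≡v₂g
  where
  open ≡-Reasoning
  distribute : ∀ α β v₁ v₂ g → (α * v₁ + β * v₂) * g ≡ α * (v₁ * g) + β * (v₂ * g)
  distribute = solve-∀
  combination : (α * v₁ + β * v₂) * g ≡ 1ℤ * g
  combination = begin
    (α * v₁ + β * v₂) * g          ≡⟨ distribute α β v₁ v₂ g ⟩
    α * (v₁ * g) + β * (v₂ * g)    ≡⟨ cong₂ (λ a b → α * a + β * b) (sym u₁≡v₁g) (sym u₂≡v₂g) ⟩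
    α * u 𝟙 + β * u 𝟚              ≡⟨ bz ⟩
    g                              ≡⟨ sym (*-identityˡ g) ⟩
    1ℤ * g                         ∎

-- The divisor is passed explicitly to ∣ᵤ⇒∣: inferring it would make Agda evaluate gcd.
primitive-factorisation : ∀ u → ¬ IsZero u →
  ∃ λ g → g ≢ 0ℤ × ∃ λ v → Unimodular v × (∀ j → u j ≡ v j * g)
primitive-factorisation u u≢0 = gcd (u 𝟙) (u 𝟚) , gcd≢0 , unimodular-quotient u gcd≢0
  (∣ᵤ⇒∣ {k = gcd (u 𝟙) (u 𝟚)} (gcd[i,j]∣i (u 𝟙) (u 𝟚)))
  (∣ᵤ⇒∣ {k = gcd (u 𝟙) (u 𝟚)} (gcd[i,j]∣j (u 𝟙) (u 𝟚)))
  (bézout (u 𝟙) (u 𝟚))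
  where
  gcd≢0 : gcd (u 𝟙) (u 𝟚) ≢ 0ℤ
  gcd≢0 gcd≡0 = u≢0 (gcd[i,j]≡0⇒i≡0 (u 𝟙) (u 𝟚) gcd≡0 , gcd[i,j]≡0⇒j≡0 {u 𝟙} gcd≡0)

-- The multiplier is read off from a Bézout combination: s = α w₁ + β w₂.
parallel⇒multiple-of-unimodular : ∀ {v} w → Unimodular v → cross w v ≡ 0ℤ →
  ∃ λ s → ∀ j → w j ≡ s * v j
parallel⇒multiple-of-unimodular {v} w (α , β , bz) w×v≡0 = α * w 𝟙 + β * w 𝟚 , λ where
    zero       → component (w 𝟙) (v 𝟙) (- β) (expand₁ α β (w 𝟙) (w 𝟚) (v 𝟙) (v 𝟚))
    (suc zero) → component (w 𝟚) (v 𝟚) α (expand₂ α β (w 𝟙) (w 𝟚) (v 𝟙) (v 𝟚))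
  where
  open ≡-Reasoning
  expand₁ : ∀ α β w₁ w₂ v₁ v₂ →
    (α * w₁ + β * w₂) * v₁ ≡ w₁ * (α * v₁ + β * v₂) + - β * (w₁ * v₂ - w₂ * v₁)
  expand₁ = solve-∀
  expand₂ : ∀ α β w₁ w₂ v₁ v₂ →
    (α * w₁ + β * w₂) * v₂ ≡ w₂ * (α * v₁ + β * v₂) + α * (w₁ * v₂ - w₂ * v₁)
  expand₂ = solve-∀
  unit : ∀ x c → x * 1ℤ + c * 0ℤ ≡ x
  unit = solve-∀
  component : ∀ wⱼ vⱼ c → (α * w 𝟙 + β * w 𝟚) * vⱼ ≡ wⱼ * (α * v 𝟙 + β * v 𝟚) + c * cross w v →
    wⱼ ≡ (α * w 𝟙 + β * w 𝟚) * vⱼ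
  component wⱼ vⱼ c expansion = sym (begin
    (α * w 𝟙 + β * w 𝟚) * vⱼ                     ≡⟨ expansion ⟩
    wⱼ * (α * v 𝟙 + β * v 𝟚) + c * cross w v     ≡⟨ cong₂ (λ e f → wⱼ * e + c * f) bz w×v≡0 ⟩
    wⱼ * 1ℤ + c * 0ℤ                             ≡⟨ unit wⱼ c ⟩
    wⱼ                                           ∎)

rank-one-factorisation : {I : Set} (x : I → Fin 2 → ℤ) →
  (∀ m n → cross (x m) (x n) ≡ 0ℤ) → Dec (∃ λ m → ¬ IsZero (x m)) →
  ∃₂ λ v s → Unimodular v × (∀ m j → x m j ≡ s m * v j)
rank-one-factorisation x parallel (no all-zero) =
  (1ℤ ∷ 0ℤ ∷ []) , (λ _ → 0ℤ) , (1ℤ , 0ℤ , refl) ,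
  λ m → zero-row (decidable-stable (isZero? (x m)) (all-zero ∘ (m ,_)))
  where
  zero-row : ∀ {u} → IsZero u → ∀ j → u j ≡ 0ℤ * (1ℤ ∷ 0ℤ ∷ []) j
  zero-row (u₁≡0 , _) zero       = u₁≡0
  zero-row (_ , u₂≡0) (suc zero) = u₂≡0
rank-one-factorisation {I} x parallel (yes (m₀ , x₀≢0)) =
  factor-through (primitive-factorisation (x m₀) x₀≢0)
  where
  factor-through : (∃ λ g → g ≢ 0ℤ × ∃ λ v → Unimodular v × (∀ j → x m₀ j ≡ v j * g)) →
    ∃₂ λ v s → Unimodular v × (∀ m j → x m j ≡ s m * v j)
  factor-through (g , g≢0 , v , v-unimodular , x₀≡vg) =
    v , (λ m → proj₁ (multiple m)) , v-unimodular , (λ m → proj₂ (multiple m))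
    where
    scale-cross : ∀ w₁ w₂ v₁ v₂ g → w₁ * (v₂ * g) - w₂ * (v₁ * g) ≡ (w₁ * v₂ - w₂ * v₁) * g
    scale-cross = solve-∀
    parallel-to-v : ∀ m → cross (x m) v ≡ 0ℤ
    parallel-to-v m = i*j≡0⇒i≡0 g≢0 (begin
      cross (x m) v * g                          ≡⟨ sym (scale-cross (x m 𝟙) (x m 𝟚) (v 𝟙) (v 𝟚) g) ⟩
      x m 𝟙 * (v 𝟚 * g) - x m 𝟚 * (v 𝟙 * g)     ≡⟨ cong₂ (λ a b → x m 𝟙 * a - x m 𝟚 * b)
                                                          (sym (x₀≡vg 𝟚)) (sym (x₀≡vg 𝟙)) ⟩
      cross (x m) (x m₀)                         ≡⟨ parallel m m₀ ⟩
      0ℤ                                         ∎)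
      where open ≡-Reasoning
    multiple : ∀ m → ∃ λ s → ∀ j → x m j ≡ s * v j
    multiple m = parallel⇒multiple-of-unimodular {v} (x m) v-unimodular (parallel-to-v m)

scaled-squares⇒≡0 : ∀ d l → Unimodular l → d * (l 𝟙 * l 𝟙) ≡ 0ℤ → d * (l 𝟚 * l 𝟚) ≡ 0ℤ → d ≡ 0ℤ
scaled-squares⇒≡0 d l (α , β , bz) dl₁²≡0 dl₂²≡0 = decidable-stable (d ≟ 0ℤ) λ d≢0 →
  let l₁≡0 = square≡0⇒≡0 (i*j≡0⇒j≡0 d≢0 dl₁²≡0)
      l₂≡0 = square≡0⇒≡0 (i*j≡0⇒j≡0 d≢0 dl₂²≡0)
  in 0≢1 (trans (sym (annihilate α β)) (trans (cong₂ (λ a b → α * a + β * b) (sym l₁≡0) (sym l₂≡0)) bz))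
  where
  annihilate : ∀ α β → α * 0ℤ + β * 0ℤ ≡ 0ℤ
  annihilate = solve-∀
  0≢1 : 0ℤ ≢ 1ℤ
  0≢1 ()

eval : BQF → ℤ → ℤ → ℤ
eval (bqf p q r) u₁ u₂ = p * u₁ * u₁ + q * u₁ * u₂ + r * u₂ * u₂

vanishesId? : ∀ B → Dec (VanishesId B)
vanishesId? (bqf p q r) = (p ≟ 0ℤ) ×-dec (q ≟ 0ℤ) ×-dec (r ≟ 0ℤ)

eval-vanishesId : ∀ {B} → VanishesId B → ∀ u₁ u₂ → eval B u₁ u₂ ≡ 0ℤ
eval-vanishesId {bqf _ _ _} (refl , refl , refl) u₁ u₂ = refl

vanishesId-of-values : ∀ {B} → (∀ u₁ u₂ → eval B u₁ u₂ ≡ 0ℤ) → VanishesId B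
vanishesId-of-values {bqf p q r} B≗0 =
  trans (c₁-value p q r) (B≗0 1ℤ 0ℤ) ,
  trans (c₂-values p q r) (cong₂ _-_ (cong₂ _-_ (B≗0 1ℤ 1ℤ) (B≗0 1ℤ 0ℤ)) (B≗0 0ℤ 1ℤ)) ,
  trans (c₃-value p q r) (B≗0 0ℤ 1ℤ)
  where
  c₁-value : ∀ p q r → p ≡ p * 1ℤ * 1ℤ + q * 1ℤ * 0ℤ + r * 0ℤ * 0ℤ
  c₁-value = solve-∀
  c₂-values : ∀ p q r → q ≡ (p * 1ℤ * 1ℤ + q * 1ℤ * 1ℤ + r * 1ℤ * 1ℤ)
                          - (p * 1ℤ * 1ℤ + q * 1ℤ * 0ℤ + r * 0ℤ * 0ℤ)
                          - (p * 0ℤ * 0ℤ + q * 0ℤ * 1ℤ + r * 1ℤ * 1ℤ)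
  c₂-values = solve-∀
  c₃-value : ∀ p q r → r ≡ p * 0ℤ * 0ℤ + q * 0ℤ * 1ℤ + r * 1ℤ * 1ℤ
  c₃-value = solve-∀

product-of-values⇒vanishesId : ∀ B C → (∀ u₁ u₂ v₁ v₂ → eval B u₁ u₂ * eval C v₁ v₂ ≡ 0ℤ) →
  VanishesId B ⊎ VanishesId C
product-of-values⇒vanishesId B C BC≡0 with vanishesId? B
... | yes B≡0 = inj₁ B≡0
... | no B≢0  = inj₂ (vanishesId-of-values λ v₁ v₂ →
  decidable-stable (eval C v₁ v₂ ≟ 0ℤ) λ Cv≢0 →
    B≢0 (vanishesId-of-values λ u₁ u₂ → i*j≡0⇒i≡0 Cv≢0 (BC≡0 u₁ u₂ v₁ v₂)))

scale : ℤ → BQF → BQF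
scale d (bqf p q r) = bqf (d * p) (d * q) (d * r)

square : (Fin 2 → ℤ) → BQF
square l = bqf (l 𝟙 * l 𝟙) ((+ 2 * l 𝟙) * l 𝟚) (l 𝟚 * l 𝟚)

hyper : ℤ → ℤ → ℤ → ℤ → ℤ → ℤ → ℤ → ℤ → Hyper
hyper a₁₁₁ a₁₁₂ a₁₂₁ a₁₂₂ a₂₁₁ a₂₁₂ a₂₂₁ a₂₂₂ =
  ((a₁₁₁ ∷ a₁₁₂ ∷ []) ∷ (a₁₂₁ ∷ a₁₂₂ ∷ []) ∷ []) ∷ ((a₂₁₁ ∷ a₂₁₂ ∷ []) ∷ (a₂₂₁ ∷ a₂₂₂ ∷ []) ∷ []) ∷ []

-- Δxy A, Δyz A and Δzx A only read the entries of A, so they are definitionally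
-- the forms of the hypermatrix rebuilt from those entries.
entries : Hyper → Hyper
entries A = hyper (A 𝟙 𝟙 𝟙) (A 𝟙 𝟙 𝟚) (A 𝟙 𝟚 𝟙) (A 𝟙 𝟚 𝟚) (A 𝟚 𝟙 𝟙) (A 𝟚 𝟙 𝟚) (A 𝟚 𝟚 𝟙) (A 𝟚 𝟚 𝟚)

_≗₃_ : Hyper → Hyper → Set
A ≗₃ B = ∀ i j k → A i j k ≡ B i j k

hyper-cong : ∀ {a₁₁₁ a₁₁₂ a₁₂₁ a₁₂₂ a₂₁₁ a₂₁₂ a₂₂₁ a₂₂₂ b₁₁₁ b₁₁₂ b₁₂₁ b₁₂₂ b₂₁₁ b₂₁₂ b₂₂₁ b₂₂₂} →
  a₁₁₁ ≡ b₁₁₁ → a₁₁₂ ≡ b₁₁₂ → a₁₂₁ ≡ b₁₂₁ → a₁₂₂ ≡ b₁₂₂ → a₂₁₁ ≡ b₂₁₁ → a₂₁₂ ≡ b₂₁₂ → a₂₂₁ ≡ b₂₂₁ → a₂₂₂ ≡ b₂₂₂ →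
  hyper a₁₁₁ a₁₁₂ a₁₂₁ a₁₂₂ a₂₁₁ a₂₁₂ a₂₂₁ a₂₂₂ ≡ hyper b₁₁₁ b₁₁₂ b₁₂₁ b₁₂₂ b₂₁₁ b₂₁₂ b₂₂₁ b₂₂₂
hyper-cong refl refl refl refl refl refl refl refl = refl

entries-cong : ∀ {A B} → A ≗₃ B → entries A ≡ entries B
entries-cong A≗B = hyper-cong (A≗B 𝟙 𝟙 𝟙) (A≗B 𝟙 𝟙 𝟚) (A≗B 𝟙 𝟚 𝟙) (A≗B 𝟙 𝟚 𝟚)
                              (A≗B 𝟚 𝟙 𝟙) (A≗B 𝟚 𝟙 𝟚) (A≗B 𝟚 𝟚 𝟙) (A≗B 𝟚 𝟚 𝟚)

module _ {A B : Hyper} (A≗B : A ≗₃ B) where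

  Δxy-cong : Δxy A ≡ Δxy B
  Δxy-cong = cong Δxy (entries-cong A≗B)

  Δyz-cong : Δyz A ≡ Δyz B
  Δyz-cong = cong Δyz (entries-cong A≗B)

  Δzx-cong : Δzx A ≡ Δzx B
  Δzx-cong = cong Δzx (entries-cong A≗B)

outer : (Fin 2 → ℤ) → (Fin 2 → Fin 2 → ℤ) → Hyper
outer l b i j k = l j * b i k

det : (Fin 2 → Fin 2 → ℤ) → ℤ
det b = cross (b 𝟙) (b 𝟚)

rows-parallel : ∀ b → det b ≡ 0ℤ → ∀ i i′ → cross (b i) (b i′) ≡ 0ℤ
rows-parallel b det≡0 zero       zero       = cross-self (b 𝟙)
rows-parallel b det≡0 zero       (suc zero) = det≡0
rows-parallel b det≡0 (suc zero) zero       = parallel-sym (b 𝟙) (b 𝟚) det≡0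
rows-parallel b det≡0 (suc zero) (suc zero) = cross-self (b 𝟚)

Δzx-outer : ∀ l b → Δzx (outer l b) ≡ scale (det b) (square l)
Δzx-outer l b = cong₃ bqf (c₁ (l 𝟙) (b 𝟙 𝟙) (b 𝟙 𝟚) (b 𝟚 𝟙) (b 𝟚 𝟚))
                          (c₂ (l 𝟙) (l 𝟚) (b 𝟙 𝟙) (b 𝟙 𝟚) (b 𝟚 𝟙) (b 𝟚 𝟚))
                          (c₁ (l 𝟚) (b 𝟙 𝟙) (b 𝟙 𝟚) (b 𝟚 𝟙) (b 𝟚 𝟚))
  where
  c₁ : ∀ l b₁₁ b₁₂ b₂₁ b₂₂ →
    l * b₁₁ * (l * b₂₂) - l * b₁₂ * (l * b₂₁) ≡ (b₁₁ * b₂₂ - b₁₂ * b₂₁) * (l * l)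
  c₁ = solve-∀
  c₂ : ∀ l₁ l₂ b₁₁ b₁₂ b₂₁ b₂₂ →
    l₁ * b₁₁ * (l₂ * b₂₂) + l₁ * b₂₂ * (l₂ * b₁₁) - l₁ * b₁₂ * (l₂ * b₂₁) - l₁ * b₂₁ * (l₂ * b₁₂)
      ≡ (b₁₁ * b₂₂ - b₁₂ * b₂₁) * (+ 2 * l₁ * l₂)
  c₂ = solve-∀

yFiber : Hyper → Fin 2 × Fin 2 → Fin 2 → ℤ
yFiber A (i , k) j = A i j k

minor : Hyper → Fin 2 × Fin 2 → Fin 2 × Fin 2 → ℤ
minor A p q = cross (yFiber A p) (yFiber A q)

Δxy-minors : ∀ A → Δxy A ≡
  bqf (minor A (𝟙 , 𝟙) (𝟚 , 𝟙)) (minor A (𝟙 , 𝟙) (𝟚 , 𝟚) + minor A (𝟙 , 𝟚) (𝟚 , 𝟙)) (minor A (𝟙 , 𝟚) (𝟚 , 𝟚))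
Δxy-minors A = cong (λ c → bqf (BQF.c₁ (Δxy A)) c (BQF.c₃ (Δxy A)))
  (c₂ (A 𝟙 𝟙 𝟙) (A 𝟙 𝟙 𝟚) (A 𝟙 𝟚 𝟙) (A 𝟙 𝟚 𝟚) (A 𝟚 𝟙 𝟙) (A 𝟚 𝟙 𝟚) (A 𝟚 𝟚 𝟙) (A 𝟚 𝟚 𝟚))
  where
  c₂ : ∀ a₁₁₁ a₁₁₂ a₁₂₁ a₁₂₂ a₂₁₁ a₂₁₂ a₂₂₁ a₂₂₂ →
    a₁₁₁ * a₂₂₂ + a₁₁₂ * a₂₂₁ - a₂₁₂ * a₁₂₁ - a₂₁₁ * a₁₂₂
      ≡ (a₁₁₁ * a₂₂₂ - a₁₂₁ * a₂₁₂) + (a₁₁₂ * a₂₂₁ - a₁₂₂ * a₂₁₁)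
  c₂ = solve-∀

Δyz-minors : ∀ A → Δyz A ≡
  bqf (minor A (𝟙 , 𝟙) (𝟙 , 𝟚)) (minor A (𝟙 , 𝟙) (𝟚 , 𝟚) - minor A (𝟙 , 𝟚) (𝟚 , 𝟙)) (minor A (𝟚 , 𝟙) (𝟚 , 𝟚))
Δyz-minors A = cong₃ bqf
  (cong (λ c → A 𝟙 𝟙 𝟙 * A 𝟙 𝟚 𝟚 - c) (*-comm (A 𝟙 𝟙 𝟚) (A 𝟙 𝟚 𝟙)))
  (c₂ (A 𝟙 𝟙 𝟙) (A 𝟙 𝟙 𝟚) (A 𝟙 𝟚 𝟙) (A 𝟙 𝟚 𝟚) (A 𝟚 𝟙 𝟙) (A 𝟚 𝟙 𝟚) (A 𝟚 𝟚 𝟙) (A 𝟚 𝟚 𝟚))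
  (cong (λ c → A 𝟚 𝟙 𝟙 * A 𝟚 𝟚 𝟚 - c) (*-comm (A 𝟚 𝟙 𝟚) (A 𝟚 𝟚 𝟙)))
  where
  c₂ : ∀ a₁₁₁ a₁₁₂ a₁₂₁ a₁₂₂ a₂₁₁ a₂₁₂ a₂₂₁ a₂₂₂ →
    a₁₁₁ * a₂₂₂ + a₂₁₁ * a₁₂₂ - a₁₁₂ * a₂₂₁ - a₂₁₂ * a₁₂₁
      ≡ (a₁₁₁ * a₂₂₂ - a₁₂₁ * a₂₁₂) - (a₁₁₂ * a₂₂₁ - a₁₂₂ * a₂₁₁)
  c₂ = solve-∀

yFibers-parallel⇒vanishesId : ∀ A → (∀ p q → minor A p q ≡ 0ℤ) → VanishesId (Δxy A) × VanishesId (Δyz A)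
yFibers-parallel⇒vanishesId A m≡0 =
  subst VanishesId (sym (Δxy-minors A)) (m≡0 _ _ , cong₂ _+_ (m≡0 _ _) (m≡0 _ _) , m≡0 _ _) ,
  subst VanishesId (sym (Δyz-minors A)) (m≡0 _ _ , cong₂ _-_ (m≡0 _ _) (m≡0 _ _) , m≡0 _ _)

vanishesId⇒yFibers-parallel : ∀ A → VanishesId (Δxy A) → VanishesId (Δyz A) → ∀ p q → minor A p q ≡ 0ℤ
vanishesId⇒yFibers-parallel A Δxy≡0 Δyz≡0 =
  let m₁₂ , m₁₄+m₃₂ , m₃₄ = subst VanishesId (Δxy-minors A) Δxy≡0
      m₁₃ , m₁₄-m₃₂ , m₂₄ = subst VanishesId (Δyz-minors A) Δyz≡0
      m₁₄ , m₃₂ = sum-and-difference≡0 m₁₄+m₃₂ m₁₄-m₃₂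
  in λ where
    (zero , zero)         (zero , zero)         → cross-self (f P₁)
    (zero , zero)         (suc zero , zero)     → m₁₂
    (zero , zero)         (zero , suc zero)     → m₁₃
    (zero , zero)         (suc zero , suc zero) → m₁₄
    (suc zero , zero)     (zero , zero)         → parallel-sym (f P₁) (f P₂) m₁₂
    (suc zero , zero)     (suc zero , zero)     → cross-self (f P₂)
    (suc zero , zero)     (zero , suc zero)     → parallel-sym (f P₃) (f P₂) m₃₂
    (suc zero , zero)     (suc zero , suc zero) → m₂₄
    (zero , suc zero)     (zero , zero)         → parallel-sym (f P₁) (f P₃) m₁₃
    (zero , suc zero)     (suc zero , zero)     → m₃₂
    (zero , suc zero)     (zero , suc zero)     → cross-self (f P₃)
    (zero , suc zero)     (suc zero , suc zero) → m₃₄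
    (suc zero , suc zero) (zero , zero)         → parallel-sym (f P₁) (f P₄) m₁₄
    (suc zero , suc zero) (suc zero , zero)     → parallel-sym (f P₂) (f P₄) m₂₄
    (suc zero , suc zero) (zero , suc zero)     → parallel-sym (f P₃) (f P₄) m₃₄
    (suc zero , suc zero) (suc zero , suc zero) → cross-self (f P₄)
  where
  f : Fin 2 × Fin 2 → Fin 2 → ℤ
  f = yFiber A
  P₁ P₂ P₃ P₄ : Fin 2 × Fin 2
  P₁ = 𝟙 , 𝟙
  P₂ = 𝟚 , 𝟙
  P₃ = 𝟙 , 𝟚
  P₄ = 𝟚 , 𝟚

outer-vanishesId : ∀ {A} l b → A ≗₃ outer l b → VanishesId (Δxy A) × VanishesId (Δyz A)
outer-vanishesId l b A≗lb =
  let Δxy≡0 , Δyz≡0 = yFibers-parallel⇒vanishesId (outer l b) parallel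
  in subst VanishesId (sym (Δxy-cong A≗lb)) Δxy≡0 , subst VanishesId (sym (Δyz-cong A≗lb)) Δyz≡0
  where
  identity : ∀ l₁ l₂ s t → l₁ * s * (l₂ * t) - l₂ * s * (l₁ * t) ≡ 0ℤ
  identity = solve-∀
  parallel : ∀ p q → minor (outer l b) p q ≡ 0ℤ
  parallel (i , k) (i′ , k′) = identity (l 𝟙) (l 𝟚) (b i k) (b i′ k′)

zCoefficient : Hyper → ℤ → ℤ → ℤ → ℤ → Fin 2 → ℤ
zCoefficient A x₁ x₂ y₁ y₂ k = A 𝟙 𝟙 k * x₁ * y₁ + A 𝟙 𝟚 k * x₁ * y₂ + A 𝟚 𝟙 k * x₂ * y₁ + A 𝟚 𝟚 k * x₂ * y₂

Δyz*Δzx≡-Δxy : ∀ A x₁ x₂ y₁ y₂ → let f = zCoefficient A x₁ x₂ y₁ y₂ in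
  eval (Δyz A) x₁ x₂ * eval (Δzx A) y₁ y₂ ≡ - eval (Δxy A) (f 𝟚) (- f 𝟙)
Δyz*Δzx≡-Δxy A = identity (A 𝟙 𝟙 𝟙) (A 𝟙 𝟙 𝟚) (A 𝟙 𝟚 𝟙) (A 𝟙 𝟚 𝟚) (A 𝟚 𝟙 𝟙) (A 𝟚 𝟙 𝟚) (A 𝟚 𝟚 𝟙) (A 𝟚 𝟚 𝟚)
  where
  identity : ∀ a₁₁₁ a₁₁₂ a₁₂₁ a₁₂₂ a₂₁₁ a₂₁₂ a₂₂₁ a₂₂₂ x₁ x₂ y₁ y₂ →
    let xy₁ = a₁₁₁ * a₂₂₁ - a₁₂₁ * a₂₁₁
        xy₂ = a₁₁₁ * a₂₂₂ + a₁₁₂ * a₂₂₁ - a₂₁₂ * a₁₂₁ - a₂₁₁ * a₁₂₂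
        xy₃ = a₁₁₂ * a₂₂₂ - a₁₂₂ * a₂₁₂
        yz₁ = a₁₁₁ * a₁₂₂ - a₁₁₂ * a₁₂₁
        yz₂ = a₁₁₁ * a₂₂₂ + a₂₁₁ * a₁₂₂ - a₁₁₂ * a₂₂₁ - a₂₁₂ * a₁₂₁
        yz₃ = a₂₁₁ * a₂₂₂ - a₂₁₂ * a₂₂₁
        zx₁ = a₁₁₁ * a₂₁₂ - a₁₁₂ * a₂₁₁
        zx₂ = a₁₁₁ * a₂₂₂ + a₂₁₂ * a₁₂₁ - a₁₁₂ * a₂₂₁ - a₂₁₁ * a₁₂₂
        zx₃ = a₁₂₁ * a₂₂₂ - a₁₂₂ * a₂₂₁
        f₁ = a₁₁₁ * x₁ * y₁ + a₁₂₁ * x₁ * y₂ + a₂₁₁ * x₂ * y₁ + a₂₂₁ * x₂ * y₂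
        f₂ = a₁₁₂ * x₁ * y₁ + a₁₂₂ * x₁ * y₂ + a₂₁₂ * x₂ * y₁ + a₂₂₂ * x₂ * y₂
    in (yz₁ * x₁ * x₁ + yz₂ * x₁ * x₂ + yz₃ * x₂ * x₂) * (zx₁ * y₁ * y₁ + zx₂ * y₁ * y₂ + zx₃ * y₂ * y₂)
         ≡ - (xy₁ * f₂ * f₂ + xy₂ * f₂ * (- f₁) + xy₃ * (- f₁) * (- f₁))
  identity = solve-∀

any²? : ∀ {P : Fin 2 × Fin 2 → Set} → (∀ p → Dec (P p)) → Dec (∃ P)
any²? P? = map′ (λ { (i , k , Pik) → (i , k) , Pik }) (λ { ((i , k) , Pik) → i , k , Pik })
  (any? λ i → any? λ k → P? (i , k))

y-factorisation : ∀ A → VanishesId (Δxy A) → VanishesId (Δyz A) →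
  ∃₂ λ l b → Unimodular l × A ≗₃ outer l b
y-factorisation A Δxy≡0 Δyz≡0 =
  let l , b , l-unimodular , fiber≡bl =
        rank-one-factorisation (yFiber A) (vanishesId⇒yFibers-parallel A Δxy≡0 Δyz≡0)
                               (any²? λ p → ¬? (isZero? (yFiber A p)))
  in l , (λ i k → b (i , k)) , l-unimodular ,
     λ i j k → trans (fiber≡bl (i , k) j) (*-comm (b (i , k)) (l j))

Δyz-or-Δzx-vanishes : ∀ A → VanishesId (Δxy A) → VanishesId (Δyz A) ⊎ VanishesId (Δzx A)
Δyz-or-Δzx-vanishes A Δxy≡0 = product-of-values⇒vanishesId (Δyz A) (Δzx A) λ x₁ x₂ y₁ y₂ →
  let f = zCoefficient A x₁ x₂ y₁ y₂ in
  trans (Δyz*Δzx≡-Δxy A x₁ x₂ y₁ y₂) (cong -_ (eval-vanishesId Δxy≡0 (f 𝟚) (- f 𝟙)))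

vanishing-of-splits : ∀ A → SplitsLinearℤ A →
  VanishesId (Δxy A) × VanishesId (Δyz A) × VanishesId (Δzx A)
vanishing-of-splits A (u , v , w , A≡uvw) =
  let Δxy≡0 , Δyz≡0 = outer-vanishesId v b A≗vb
  in Δxy≡0 , Δyz≡0 , subst VanishesId (sym (trans (Δzx-cong A≗vb) (Δzx-outer v b))) dv²≡0
  where
  b : Fin 2 → Fin 2 → ℤ
  b i k = u i * w k
  rearrange : ∀ u v w → u * v * w ≡ v * (u * w)
  rearrange = solve-∀
  A≗vb : A ≗₃ outer v b
  A≗vb i j k = trans (A≡uvw i j k) (rearrange (u i) (v j) (w k))
  det-outer : ∀ u₁ u₂ w₁ w₂ → u₁ * w₁ * (u₂ * w₂) - u₁ * w₂ * (u₂ * w₁) ≡ 0ℤ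
  det-outer = solve-∀
  dv²≡0 : VanishesId (scale (det b) (square v))
  dv²≡0 = subst (λ d → VanishesId (scale d (square v))) (sym (det-outer (u 𝟙) (u 𝟚) (w 𝟙) (w 𝟚)))
                (refl , refl , refl)

splits-of-vanishing : ∀ A → VanishesId (Δxy A) × VanishesId (Δyz A) × VanishesId (Δzx A) →
  SplitsLinearℤ A
splits-of-vanishing A (Δxy≡0 , Δyz≡0 , Δzx≡0) =
  let l , b , l-unimodular , A≗lb = y-factorisation A Δxy≡0 Δyz≡0
      dl₁²≡0 , _ , dl₂²≡0 = subst VanishesId (trans (Δzx-cong A≗lb) (Δzx-outer l b)) Δzx≡0
      det≡0 = scaled-squares⇒≡0 (det b) l l-unimodular dl₁²≡0 dl₂²≡0
      w , u , _ , b≡uw = rank-one-factorisation b (rows-parallel b det≡0) (any? λ i → ¬? (isZero? (b i)))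
  in u , l , w ,
     λ i j k → trans (A≗lb i j k) (trans (cong (l j *_) (b≡uw i k)) (rearrange (l j) (u i) (w k)))
  where
  rearrange : ∀ l u w → l * (u * w) ≡ u * l * w
  rearrange = solve-∀

-- ι n = n / 1 is definitionally fromℚᵘ (mkℚᵘ n 0), whose products and negations stay exact.
toℚᵘ-ι : ∀ n → Q.toℚᵘ (ι n) ≃ mkℚᵘ n 0
toℚᵘ-ι n = toℚᵘ-fromℚᵘ (mkℚᵘ n 0)

ι-* : ∀ m n → ι (m * n) ≡ ι m Q.* ι n
ι-* m n = toℚᵘ-injective (begin
  Q.toℚᵘ (ι (m * n))              ≈⟨ toℚᵘ-ι (m * n) ⟩
  mkℚᵘ m 0 *ᵘ mkℚᵘ n 0            ≈⟨ *-cong (toℚᵘ-ι m) (toℚᵘ-ι n) ⟨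
  Q.toℚᵘ (ι m) *ᵘ Q.toℚᵘ (ι n)    ≈⟨ toℚᵘ-homo-* (ι m) (ι n) ⟨
  Q.toℚᵘ (ι m Q.* ι n)            ∎)
  where open ≃-Reasoning

ι-+ : ∀ m n → ι (m + n) ≡ ι m Q.+ ι n
ι-+ m n = toℚᵘ-injective (begin
  Q.toℚᵘ (ι (m + n))              ≈⟨ toℚᵘ-ι (m + n) ⟩
  mkℚᵘ (m + n) 0                  ≈⟨ *≡* (identity m n) ⟩
  mkℚᵘ m 0 +ᵘ mkℚᵘ n 0            ≈⟨ +-cong (toℚᵘ-ι m) (toℚᵘ-ι n) ⟨
  Q.toℚᵘ (ι m) +ᵘ Q.toℚᵘ (ι n)    ≈⟨ toℚᵘ-homo-+ (ι m) (ι n) ⟨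
  Q.toℚᵘ (ι m Q.+ ι n)            ∎)
  where
  open ≃-Reasoning
  identity : ∀ m n → (m + n) * + 1 ≡ (m * + 1 + n * + 1) * + 1
  identity = solve-∀

ι-neg : ∀ n → ι (- n) ≡ Q.- ι n
ι-neg n = toℚᵘ-injective (begin
  Q.toℚᵘ (ι (- n))                ≈⟨ toℚᵘ-ι (- n) ⟩
  -ᵘ mkℚᵘ n 0                     ≈⟨ -‿cong (toℚᵘ-ι n) ⟨
  -ᵘ Q.toℚᵘ (ι n)                 ≈⟨ toℚᵘ-homo‿- (ι n) ⟨
  Q.toℚᵘ (Q.- ι n)                ∎)
  where open ≃-Reasoning

ι-- : ∀ m n → ι (m - n) ≡ ι m Q.- ι n
ι-- m n = trans (ι-+ m (- n)) (cong (ι m Q.+_) (ι-neg n))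

ι-det : ∀ b → ι (det b) ≡ detQ (λ i k → ι (b i k))
ι-det b = trans (ι-- (b 𝟙 𝟙 * b 𝟚 𝟚) (b 𝟙 𝟚 * b 𝟚 𝟙))
                (cong₂ Q._-_ (ι-* (b 𝟙 𝟙) (b 𝟚 𝟚)) (ι-* (b 𝟙 𝟚) (b 𝟚 𝟙)))

ΔzxFormula-ι : ∀ A l b → Δzx A ≡ scale (det b) (square l) →
  ΔzxFormula A (λ j → ι (l j)) (λ i k → ι (b i k))
ΔzxFormula-ι A l b Δzx≡dl² =
  coefficient (cong BQF.c₁ Δzx≡dl²) (ι-* (l 𝟙) (l 𝟙)) ,
  coefficient (cong BQF.c₂ Δzx≡dl²)
    (trans (ι-* (+ 2 * l 𝟙) (l 𝟚)) (cong (Q._* ι (l 𝟚)) (ι-* (+ 2) (l 𝟙)))) ,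
  coefficient (cong BQF.c₃ Δzx≡dl²) (ι-* (l 𝟚) (l 𝟚))
  where
  coefficient : ∀ {c x q} → c ≡ det b * x → ι x ≡ q → ι c ≡ detQ (λ i k → ι (b i k)) Q.* q
  coefficient {x = x} c≡dx ιx≡q =
    trans (cong ι c≡dx) (trans (ι-* (det b) x) (cong₂ Q._*_ (ι-det b) ιx≡q))

rational-factorisation : ∀ A → VanishesId (Δxy A) → VanishesId (Δyz A) →
  Σ LinQ λ l → Σ BilQ λ b → FactorsQ A l b × ΔzxFormula A l b
rational-factorisation A Δxy≡0 Δyz≡0 =
  let l , b , _ , A≗lb = y-factorisation A Δxy≡0 Δyz≡0 in
  (λ j → ι (l j)) , (λ i k → ι (b i k)) ,
  (λ i j k → trans (cong ι (A≗lb i j k)) (ι-* (l j) (b i k))) ,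
  ΔzxFormula-ι A l b (trans (Δzx-cong A≗lb) (Δzx-outer l b))

mainTheorem3 : (A : Hyper) →
    (VanishesId (Δxy A) → VanishesId (Δyz A) ⊎ VanishesId (Δzx A)) ×
    (VanishesId (Δxy A) → VanishesId (Δyz A) →
      Σ LinQ λ l → Σ BilQ λ b → FactorsQ A l b × ΔzxFormula A l b) ×
    (HasLinearFactorYℤ A → VanishesId (Δxy A) × VanishesId (Δyz A)) ×
    (SplitsLinearℤ A ⇔ (VanishesId (Δxy A) × VanishesId (Δyz A) × VanishesId (Δzx A)))
mainTheorem3 A =
  Δyz-or-Δzx-vanishes A ,
  rational-factorisation A ,
  (λ (l , b , _ , A≗lb) → outer-vanishesId l b A≗lb) ,
  mk⇔ (vanishing-of-splits A) (splits-of-vanishing A)
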